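{- Let $n$ be a positive integer and let $a,b\in\{0,1,2\}$ with $b-a\equiv 1 \pmod 3$. Let $\mathcal{F}\subseteq\mathscr{P}(n)$ be an $(a,b)$-town$\pmod 3$. Suppose that one of the following holds: (1) $n\equiv 2\pmod 3$; (2) $n\equiv 0\pmod 3$ and $a=0$, $b=1$. Then $|\mathcal{F}|\leq n-1$.
   Context: $[n]=\{1,2,\ldots,n\}$ and $\mathscr{P}(n)$ is the power set of $[n]$; a family $\mathcal{F}\subseteq\mathscr{P}(n)$ is a set of (distinct) subsets of $[n]$. For integers $k\ge 2$ and $0\le a,b\le k-1$, a family $\mathcal{F}\subseteq\mathscr{P}(n)$ is an $(a,b)$-town$\pmod k$ if for any distinct $A,B\in\mathcal{F}$ we have $|A|\equiv a\pmod k$ and $|A\cap B|\equiv b\pmod k$; that is, every set in $\mathcal{F}$ has cardinality $\equiv a\pmod k$ and every intersection of two distinct sets of $\mathcal{F}$ has cardinality $\equiv b\pmod k$. -}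

module Defs where

open import Data.Nat using (ℕ)
open import Data.Integer using (ℤ; +_; _-_)
open import Data.Integer.Divisibility using (_∣_)
open import Data.Fin.Subset using (Subset; _∩_; ∣_∣)
open import Data.List using (List)
open import Data.List.Membership.Propositional using (_∈_)
open import Relation.Binary.PropositionalEquality using (_≢_)

infix 4 _≡_[mod_]

-- Stated over ℤ because differences of residues may be negative.
_≡_[mod_] : ℤ → ℤ → ℕ → Set
x ≡ y [mod k ] = (+ k) ∣ (x - y)

-- A family of subsets of an n-element set is given by a list of its members.
-- Repetitions do not matter here; where the size of the family matters, the
-- list must be required to be Unique, so that its length is that size.
record IsTown (k a b : ℕ) {n : ℕ} (F : List (Subset n)) : Set where
  field
    size         : ∀ {A} → A ∈ F → + ∣ A ∣ ≡ + a [mod k ]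
    intersection : ∀ {A B} → A ∈ F → B ∈ F → A ≢ B →
                   + ∣ A ∩ B ∣ ≡ + b [mod k ]

{-# OPTIONS --safe #-}

-- Let vᵢ be the indicator vectors of n members of the town, 𝟏 the all-ones vector
-- and xᵢ = vᵢ + a𝟏.  Under either hypothesis (n + 1) a ≡ 0 (mod 3), so every xᵢ has
-- coordinate sum 0 and xᵢ · xₖ ≡ e − [i = k] with e = 1 + a + a².  Being n vectors
-- in a hyperplane of 𝔽₃ⁿ, the xᵢ satisfy a nontrivial relation Σ cᵢ xᵢ = 0; pairing
-- it with xₖ gives cₖ = e Σ cᵢ, and summing over k gives n e ≡ 1, i.e. n ≡ 1 + a + a²,
-- which neither hypothesis allows.

module Submission where

open import Defs
open import Algebra.Bundles using (CommutativeRing)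
open import Algebra.Definitions using (AlmostLeftCancellative)
open import Data.Bool using (true; false; if_then_else_)
open import Data.Fin using (Fin; zero; suc; punchIn; inject≤)
open import Data.Fin.Properties using (¬∀⟶∃¬; all?; punchInᵢ≢i; inject≤-injective)
open import Data.Fin.Subset using (Subset; _∩_; ∣_∣)
open import Data.Fin.Subset.Properties using (∩-idem)
open import Data.Integer using (ℤ; +_; _-_; 0ℤ; 1ℤ)
import Data.Integer as ℤ
open import Data.Integer.Divisibility.Signed
  using (_∣_; divides; _∣?_; ∣ᵤ⇒∣; ∣⇒∣ᵤ; ∣m∣n⇒∣m+n; ∣m⇒∣-m; ∣m⇒∣m*n; ∣n⇒∣m*n)
import Data.Integer.Properties as ℤ
open import Data.Integer.Tactic.RingSolver using (solve-∀)
open import Data.List using (List; length; lookup)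
open import Data.List.Membership.Propositional.Properties using (∈-lookup)
import Data.List.Relation.Unary.All as All
open import Data.List.Relation.Unary.AllPairs using (_∷_)
open import Data.List.Relation.Unary.Unique.Propositional using (Unique)
open import Data.Nat using (ℕ; zero; suc; _<_; _≤_; _∸_; s≤s)
open import Data.Nat.Primality using (Prime; prime?; euclidsLemma; ¬prime[1])
import Data.Nat.Divisibility as ℕ
open import Data.Nat.Properties using (≮⇒≥)
open import Data.Product using (_×_; _,_; ∃)
open import Data.Sum using (_⊎_; inj₁; inj₂)
open import Data.Vec using ([]; _∷_)
import Data.Vec as Vec
open import Data.Vec.Functional using (Vector; insertAt; removeAt)
open import Data.Vec.Functional.Properties using (insertAt-lookup; insertAt-punchIn)
open import Function using (_∘_; const)
open import Level using (0ℓ)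
open import Relation.Binary.PropositionalEquality using (_≡_; _≢_; cong; subst)
import Relation.Binary.PropositionalEquality as ≡
open import Relation.Nullary using (Dec; yes; no; ¬_; contradiction)
open import Relation.Nullary.Decidable using (map′; from-yes; from-no)
import Algebra.Properties.Semiring.Sum as SemiringSum
import Algebra.Properties.Ring as RingProperties
import Algebra.Solver.Ring.NaturalCoefficients.Default as Solver
import Relation.Binary.Reasoning.Setoid as SetoidReasoning

-- Linear dependence and Gram matrices over an integral domain.

module IntegralDomain
  {r ℓ} (R : CommutativeRing r ℓ)
  (≈0? : ∀ x → Dec (CommutativeRing._≈_ R x (CommutativeRing.0# R)))
  (*-cancelˡ-nonZero : AlmostLeftCancellative
    (CommutativeRing._≈_ R) (CommutativeRing.0# R) (CommutativeRing._*_ R))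
  (1≉0 : ¬ CommutativeRing._≈_ R (CommutativeRing.1# R) (CommutativeRing.0# R))
  where

  open CommutativeRing R hiding (zero; _-_)
  open SemiringSum semiring
  open SetoidReasoning setoid
  open RingProperties ring using (-‿distribˡ-*)
  open Solver commutativeSemiring using (solve; _:=_; _:+_; _:*_)

  infix 7 _·_

  _·_ : ∀ {n} → Vector Carrier n → Vector Carrier n → Carrier
  x · y = sum (λ j → x j * y j)

  sum-zero : ∀ {n} (f : Vector Carrier n) → (∀ i → f i ≈ 0#) → sum f ≈ 0#
  sum-zero {n} f f≈0 = trans (sum-cong-≋ f≈0) (sum-replicate-zero n)

  -- A nonzero entry `f i` clears the others by cross-multiplication, with `p = f i` and
  -- `q k = - f k`. If the whole column vanishes, any row can be the pivot with `p = 1#` and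
  -- `q = 0#`, so that `dependence` treats both cases alike.
  pivot : ∀ {n} (f : Vector Carrier (suc n)) →
          ∃ λ i → ∃ λ p → ∃ λ q → ¬ p ≈ 0# × ∀ k → p * f k + q k * f i ≈ 0#
  pivot {n} f with all? (≈0? ∘ f)
  ... | yes f≈0 = zero , 1# , const 0# , 1≉0 , λ k → begin
          1# * f k + 0# * f zero  ≈⟨ +-cong (*-identityˡ (f k)) (zeroˡ (f zero)) ⟩
          f k + 0#                ≈⟨ +-identityʳ (f k) ⟩
          f k                     ≈⟨ f≈0 k ⟩
          0#                      ∎
  ... | no ¬f≈0 with ¬∀⟶∃¬ (suc n) (λ i → f i ≈ 0#) (≈0? ∘ f) ¬f≈0
  ...   | i , fi≉0 = i , f i , (λ k → - f k) , fi≉0 , λ k → begin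
          f i * f k + - f k * f i    ≈⟨ +-cong (*-comm (f k) (f i)) (-‿distribˡ-* (f k) (f i)) ⟨
          f k * f i + - (f k * f i)  ≈⟨ -‿inverseʳ (f k * f i) ⟩
          0#                         ∎

  -- Gaussian elimination, fraction-free because R need not be a field.
  dependence : ∀ n (A : Fin (suc n) → Vector Carrier n) →
               ∃ λ c → (∃ λ i → ¬ c i ≈ 0#) × ∀ j → c · (λ i → A i j) ≈ 0#
  dependence zero    A = const 1# , (zero , 1≉0) , λ ()
  dependence (suc n) A with pivot (λ i → A i zero)
  ... | i , p , q , p≉0 , eliminated
    -- After elimination, the `suc n` rows other than `i` are compared in the `n` coordinates that
    -- remain.
    with dependence n (λ k j → p * A (punchIn i k) (suc j) + q (punchIn i k) * A i (suc j))
  ... | d , (k , dk≉0) , d·B≈0 = c , (punchIn i k , ck≉0) , relation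
    where
    B : Fin (suc n) → Vector Carrier (suc n)
    B k j = p * A (punchIn i k) j + q (punchIn i k) * A i j

    -- Expanding the combination `d` of the rows `B` in terms of `A`: row `i` occurs in every `B k`
    -- with factor `q` and so collects the weight `cᵢ`, while each other row gets `p * d k`.
    cᵢ = sum (λ k → d k * q (punchIn i k))

    c : Vector Carrier (suc (suc n))
    c = insertAt (λ k → p * d k) i cᵢ

    ck≉0 : ¬ c (punchIn i k) ≈ 0#
    ck≉0 ck≈0 = dk≉0 (*-cancelˡ-nonZero p (d k) 0# p≉0 (begin
      p * d k          ≡⟨ insertAt-punchIn (λ k → p * d k) i cᵢ k ⟨
      c (punchIn i k)  ≈⟨ ck≈0 ⟩
      0#               ≈⟨ zeroʳ p ⟨
      p * 0#           ∎))

    c·A≈d·B : ∀ j → c · (λ i → A i j) ≈ d · (λ k → B k j)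
    c·A≈d·B j = begin
      c · (λ i → A i j)
        ≈⟨ sum-remove {i = i} (λ i → c i * A i j) ⟩
      c i * A i j + sum (λ k → c (punchIn i k) * A (punchIn i k) j)
        ≈⟨ +-cong
             (*-congʳ (reflexive (insertAt-lookup (λ k → p * d k) i cᵢ)))
             (sum-cong-≋ (λ k → *-congʳ {A (punchIn i k) j} (reflexive (insertAt-punchIn (λ k → p * d k) i cᵢ k)))) ⟩
      cᵢ * A i j + sum (λ k → p * d k * A (punchIn i k) j)
        ≈⟨ +-congʳ (*-distribʳ-sum (A i j) (λ k → d k * q (punchIn i k))) ⟩
      sum (λ k → d k * q (punchIn i k) * A i j) + sum (λ k → p * d k * A (punchIn i k) j)
        ≈⟨ ∑-distrib-+ (λ k → d k * q (punchIn i k) * A i j) (λ k → p * d k * A (punchIn i k) j) ⟨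
      sum (λ k → d k * q (punchIn i k) * A i j + p * d k * A (punchIn i k) j)
        ≈⟨ sum-cong-≋ (λ k → solve 5 (λ d q y p x →
             d :* q :* y :+ p :* d :* x := d :* (p :* x :+ q :* y)) refl
             (d k) (q (punchIn i k)) (A i j) p (A (punchIn i k) j)) ⟩
      d · (λ k → B k j) ∎

    -- Coordinate zero of every `B k` was cleared by the pivot; the remaining coordinates are the
    -- recursive relation.
    relation : ∀ j → c · (λ i → A i j) ≈ 0#
    relation zero    = trans (c·A≈d·B zero) (sum-zero (λ k → d k * B k zero)
      (λ k → trans (*-congˡ (eliminated (punchIn i k))) (zeroʳ (d k))))
    relation (suc j) = trans (c·A≈d·B (suc j)) (d·B≈0 j)

  dependence-of-zero-sums :
    ∀ n (X : Fin (suc n) → Vector Carrier (suc n)) → (∀ i → sum (X i) ≈ 0#) →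
    ∃ λ c → (∃ λ i → ¬ c i ≈ 0#) × ∀ j → c · (λ i → X i j) ≈ 0#
  dependence-of-zero-sums n X ΣX≈0 with dependence n (λ i j → X i (suc j))
  ... | c , c≉0 , c·X≈0 = c , c≉0 , relation
    where
    relation : ∀ j → c · (λ i → X i j) ≈ 0#
    relation (suc j) = c·X≈0 j
    -- Adding the vanishing combinations of the other coordinates turns this one into the
    -- combination `c` of the full coordinate sums, all of which are zero.
    relation zero    = begin
      c · (λ i → X i zero)
        ≈⟨ +-identityʳ _ ⟨
      c · (λ i → X i zero) + 0#
        ≈⟨ +-congˡ (sum-zero (λ j → c · (λ i → X i (suc j))) c·X≈0) ⟨
      sum (λ j → sum (λ i → c i * X i j))
        ≈⟨ ∑-comm (λ j i → c i * X i j) ⟩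
      sum (λ i → sum (λ j → c i * X i j))
        ≈⟨ sum-zero _ (λ i → trans (sym (*-distribˡ-sum (c i) (X i)))
             (trans (*-congˡ (ΣX≈0 i)) (zeroʳ (c i)))) ⟩
      0# ∎

  -- Pairing a relation Σ cᵢ Xᵢ ≈ 0 with Xₖ gives cₖ ≈ e Σ cᵢ; summing over k
  -- and cancelling Σ cᵢ yields the claim.
  gram-zero-sums :
    ∀ n (X : Fin (suc n) → Vector Carrier (suc n)) e →
    (∀ i → sum (X i) ≈ 0#) →
    (∀ i → 1# + X i · X i ≈ e) →
    (∀ i k → i ≢ k → X i · X k ≈ e) →
    sum {suc n} (const e) ≈ 1#
  gram-zero-sums n X e ΣX≈0 diagonal off-diagonal with dependence-of-zero-sums n X ΣX≈0
  ... | c , (k , ck≉0) , c·X≈0 =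
    *-cancelˡ-nonZero (sum c) (sum {suc n} (const e)) 1# Σc≉0 (begin
      sum c * sum {suc n} (const e)         ≈⟨ *-distribˡ-sum {suc n} (sum c) (const e) ⟩
      sum {suc n} (const (sum c * e))       ≈⟨ sum-cong-≋ coefficient ⟨
      sum c                                 ≈⟨ *-identityʳ (sum c) ⟨
      sum c * 1#                            ∎)
    where
    orthogonal : ∀ k → c · (λ i → X i · X k) ≈ 0#
    orthogonal k = begin
      sum (λ i → c i * sum (λ j → X i j * X k j))
        ≈⟨ sum-cong-≋ (λ i → *-distribˡ-sum (c i) (λ j → X i j * X k j)) ⟩
      sum (λ i → sum (λ j → c i * (X i j * X k j)))
        ≈⟨ ∑-comm (λ i j → c i * (X i j * X k j)) ⟩
      sum (λ j → sum (λ i → c i * (X i j * X k j)))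
        ≈⟨ sum-cong-≋ (λ j → sum-cong-≋ (λ i → *-assoc (c i) (X i j) (X k j))) ⟨
      sum (λ j → sum (λ i → c i * X i j * X k j))
        ≈⟨ sum-cong-≋ (λ j → *-distribʳ-sum (X k j) (λ i → c i * X i j)) ⟨
      sum (λ j → sum (λ i → c i * X i j) * X k j)
        ≈⟨ sum-zero _ (λ j → trans (*-congʳ (c·X≈0 j)) (zeroˡ (X k j))) ⟩
      0# ∎

    -- The extra `c k` completes the diagonal Gram entry to `1# + X k · X k`, after which every term
    -- carries the same factor `e`.
    coefficient : ∀ k → c k ≈ sum c * e
    coefficient k = begin
      c k
        ≈⟨ +-identityʳ (c k) ⟨
      c k + 0#
        ≈⟨ +-congˡ (orthogonal k) ⟨
      c k + c · (λ i → X i · X k)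
        ≈⟨ +-congˡ (sum-remove {i = k} (λ i → c i * (X i · X k))) ⟩
      c k + (c k * (X k · X k) + sum (removeAt (λ i → c i * (X i · X k)) k))
        ≈⟨ +-assoc _ _ _ ⟨
      c k + c k * (X k · X k) + sum (removeAt (λ i → c i * (X i · X k)) k)
        ≈⟨ +-congʳ (+-congʳ (*-identityʳ (c k))) ⟨
      c k * 1# + c k * (X k · X k) + sum (removeAt (λ i → c i * (X i · X k)) k)
        ≈⟨ +-cong (trans (sym (distribˡ (c k) 1# (X k · X k))) (*-congˡ (diagonal k)))
             (sum-cong-≋ (λ i → *-congˡ (off-diagonal (punchIn k i) k (punchInᵢ≢i k i)))) ⟩
      c k * e + sum (removeAt (λ i → c i * e) k)
        ≈⟨ sum-remove {i = k} (λ i → c i * e) ⟨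
      sum (λ i → c i * e)
        ≈⟨ *-distribʳ-sum e c ⟨
      sum c * e ∎

    -- Each `c k` is a multiple of `sum c`, so a zero sum would make the relation trivial.
    Σc≉0 : ¬ sum c ≈ 0#
    Σc≉0 Σc≈0 = ck≉0 (trans (coefficient k) (trans (*-congʳ Σc≈0) (zeroˡ e)))

  -- The factor `s` is pulled out so that only coordinate sums stay in the bracket, where the
  -- hypotheses of `constant-gram` can evaluate them.
  shift-· : ∀ {n} (x y : Vector Carrier n) s →
            (λ j → x j + s) · (λ j → y j + s) ≈
            x · y + s * (sum x + sum y + sum {n} (const s))
  shift-· {n} x y s = begin
    sum (λ j → (x j + s) * (y j + s))
      ≈⟨ sum-cong-≋ (λ j → solve 3 (λ x y s →
           (x :+ s) :* (y :+ s) := x :* y :+ s :* (x :+ y :+ s)) refl (x j) (y j) s) ⟩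
    sum (λ j → x j * y j + s * (x j + y j + s))
      ≈⟨ ∑-distrib-+ (λ j → x j * y j) _ ⟩
    x · y + sum (λ j → s * (x j + y j + s))
      ≈⟨ +-congˡ (*-distribˡ-sum s (λ j → x j + y j + s)) ⟨
    x · y + s * sum (λ j → x j + y j + s)
      ≈⟨ +-congˡ (*-congˡ (∑-distrib-+ (λ j → x j + y j) (const s))) ⟩
    x · y + s * (sum (λ j → x j + y j) + sum {n} (const s))
      ≈⟨ +-congˡ (*-congˡ (+-congʳ (∑-distrib-+ x y))) ⟩
    x · y + s * (sum x + sum y + sum {n} (const s)) ∎

  -- Shifting every coordinate by `s` makes the coordinate sums vanish and adds `s * s` to every
  -- Gram entry. Both `1#` plus the diagonal and the off-diagonal then equal `1# + (s + s * s)`, as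
  -- `gram-zero-sums` requires. Constant sums play the part of integer multiples in a general ring.
  constant-gram :
    ∀ n (V : Fin (suc n) → Vector Carrier (suc n)) s →
    s + sum {suc n} (const s) ≈ 0# →
    (∀ i → sum (V i) ≈ s) →
    (∀ i → V i · V i ≈ s) →
    (∀ i k → i ≢ k → V i · V k ≈ 1# + s) →
    sum {suc n} (const (1# + (s + s * s))) ≈ 1#
  constant-gram n V s s+Σs≈0 ΣV≈s diagonal off-diagonal =
    gram-zero-sums n X (1# + (s + s * s)) ΣX≈0
      (λ i → +-congˡ (trans (X·X i i) (+-congʳ (diagonal i))))
      (λ i k i≢k → trans (X·X i k)
        (trans (+-congʳ (off-diagonal i k i≢k)) (+-assoc 1# s (s * s))))
    where
    X : Fin (suc n) → Vector Carrier (suc n)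
    X i j = V i j + s

    ΣX≈0 : ∀ i → sum (X i) ≈ 0#
    ΣX≈0 i = begin
      sum (X i)                             ≈⟨ ∑-distrib-+ (V i) (const s) ⟩
      sum (V i) + sum {suc n} (const s)     ≈⟨ +-congʳ (ΣV≈s i) ⟩
      s + sum {suc n} (const s)             ≈⟨ s+Σs≈0 ⟩
      0#                                    ∎

    X·X : ∀ i k → X i · X k ≈ V i · V k + s * s
    X·X i k = begin
      X i · X k
        ≈⟨ shift-· (V i) (V k) s ⟩
      V i · V k + s * (sum (V i) + sum (V k) + sum {suc n} (const s))
        ≈⟨ +-congˡ (*-congˡ (+-congʳ (+-cong (ΣV≈s i) (ΣV≈s k)))) ⟩
      V i · V k + s * (s + s + sum {suc n} (const s))
        ≈⟨ +-congˡ (*-congˡ (+-assoc s s _)) ⟩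
      V i · V k + s * (s + (s + sum {suc n} (const s)))
        ≈⟨ +-congˡ (*-congˡ (trans (+-congˡ s+Σs≈0) (+-identityʳ s))) ⟩
      V i · V k + s * s ∎

-- The integers modulo a prime as an integral domain.

module IntegersModulo (p : ℕ) (p-prime : Prime p) where

  infix 4 _≈_ _≈?_

  -- Wrapping divisibility in a record keeps `x` and `y` visible in the type; they could not be
  -- inferred from `x - y` alone.
  record _≈_ (x y : ℤ) : Set where
    constructor congruent
    field
      divisible : + p ∣ x - y

  open _≈_

  fromMod : ∀ {x y} → x ≡ y [mod p ] → x ≈ y
  fromMod p∣x-y = congruent (∣ᵤ⇒∣ p∣x-y)

  _≈?_ : ∀ x y → Dec (x ≈ y)
  x ≈? y = map′ congruent divisible (+ p ∣? x - y)

  private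
    along : ∀ {x y} → y ≡ x → + p ∣ x → + p ∣ y
    along y≡x = subst (+ p ∣_) (≡.sym y≡x)

    reflexive : ∀ {x y} → x ≡ y → x ≈ y
    reflexive {x} ≡.refl = congruent (divides 0ℤ (ℤ.+-inverseʳ x))

    +-cong : ∀ {x y u v} → x ≈ y → u ≈ v → x ℤ.+ u ≈ y ℤ.+ v
    +-cong {x} {y} {u} {v} (congruent d) (congruent d′) =
      congruent (along (lemma x y u v) (∣m∣n⇒∣m+n d d′))
      where
      lemma : ∀ x y u v → (x ℤ.+ u) - (y ℤ.+ v) ≡ (x - y) ℤ.+ (u - v)
      lemma = solve-∀

    *-cong : ∀ {x y u v} → x ≈ y → u ≈ v → x ℤ.* u ≈ y ℤ.* v
    *-cong {x} {y} {u} {v} (congruent d) (congruent d′) =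
      congruent (along (lemma x y u v) (∣m∣n⇒∣m+n (∣m⇒∣m*n u d) (∣n⇒∣m*n y d′)))
      where
      lemma : ∀ x y u v → x ℤ.* u - y ℤ.* v ≡ (x - y) ℤ.* u ℤ.+ y ℤ.* (u - v)
      lemma = solve-∀

    -‿cong : ∀ {x y} → x ≈ y → ℤ.- x ≈ ℤ.- y
    -‿cong {x} {y} (congruent d) = congruent (along (lemma x y) (∣m⇒∣-m d))
      where
      lemma : ∀ x y → ℤ.- x - ℤ.- y ≡ ℤ.- (x - y)
      lemma = solve-∀

    sym : ∀ {x y} → x ≈ y → y ≈ x
    sym {x} {y} (congruent d) = congruent (along (lemma x y) (∣m⇒∣-m d))
      where
      lemma : ∀ x y → y - x ≡ ℤ.- (x - y)
      lemma = solve-∀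

    trans : ∀ {x y z} → x ≈ y → y ≈ z → x ≈ z
    trans {x} {y} {z} (congruent d) (congruent d′) =
      congruent (along (lemma x y z) (∣m∣n⇒∣m+n d d′))
      where
      lemma : ∀ x y z → x - z ≡ (x - y) ℤ.+ (y - z)
      lemma = solve-∀

  commutativeRing : CommutativeRing 0ℓ 0ℓ
  commutativeRing = record
    { Carrier = ℤ
    ; _≈_ = _≈_
    ; _+_ = ℤ._+_
    ; _*_ = ℤ._*_
    ; -_ = ℤ.-_
    ; 0# = 0ℤ
    ; 1# = 1ℤ
    ; isCommutativeRing = record
      { isRing = record
        { +-isAbelianGroup = record
          { isGroup = record
            { isMonoid = record
              { isSemigroup = record
                { isMagma = record
                  { isEquivalence = record { refl = reflexive ≡.refl ; sym = sym ; trans = trans }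
                  ; ∙-cong = +-cong
                  }
                ; assoc = λ x y z → reflexive (ℤ.+-assoc x y z)
                }
              ; identity = reflexive ∘ ℤ.+-identityˡ , reflexive ∘ ℤ.+-identityʳ
              }
            ; inverse = reflexive ∘ ℤ.+-inverseˡ , reflexive ∘ ℤ.+-inverseʳ
            ; ⁻¹-cong = -‿cong
            }
          ; comm = λ x y → reflexive (ℤ.+-comm x y)
          }
        ; *-cong = *-cong
        ; *-assoc = λ x y z → reflexive (ℤ.*-assoc x y z)
        ; *-identity = reflexive ∘ ℤ.*-identityˡ , reflexive ∘ ℤ.*-identityʳ
        ; distrib = (λ x y z → reflexive (ℤ.*-distribˡ-+ x y z))
                  , (λ x y z → reflexive (ℤ.*-distribʳ-+ x y z))
        }
      ; *-comm = λ x y → reflexive (ℤ.*-comm x y)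
      }
    }

  1≉0 : ¬ 1ℤ ≈ 0ℤ
  1≉0 (congruent p∣1) =
    ¬prime[1] (subst Prime (ℕ.∣1⇒≡1 (∣⇒∣ᵤ p∣1)) p-prime)

  -- Euclid's lemma for the product `x * (y - z)`; the alternative that `p` divides `x` is excluded
  -- by hypothesis.
  *-cancelˡ-nonZero : AlmostLeftCancellative _≈_ 0ℤ ℤ._*_
  *-cancelˡ-nonZero x y z x≉0 (congruent p∣xy-xz)
    with euclidsLemma ℤ.∣ x ∣ ℤ.∣ y - z ∣ p-prime
           (subst (p ℕ.∣_) (ℤ.abs-* x (y - z)) (∣⇒∣ᵤ (along (lemma x y z) p∣xy-xz)))
    where
    lemma : ∀ x y z → x ℤ.* (y - z) ≡ x ℤ.* y - x ℤ.* z
    lemma = solve-∀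
  ... | inj₁ p∣x   = contradiction (congruent (along (ℤ.+-identityʳ x) (∣ᵤ⇒∣ p∣x))) x≉0
  ... | inj₂ p∣y-z = congruent (∣ᵤ⇒∣ p∣y-z)

-- Towns modulo a prime and their indicator vectors.

lookup-injective : ∀ {a} {A : Set a} {xs : List A} → Unique xs →
                   ∀ i j → lookup xs i ≡ lookup xs j → i ≡ j
lookup-injective (_ ∷ _)    zero    zero    _  = ≡.refl
lookup-injective (x∉ ∷ _)   zero    (suc j) eq = contradiction eq (All.lookup x∉ (∈-lookup j))
lookup-injective (x∉ ∷ _)   (suc i) zero    eq =
  contradiction (≡.sym eq) (All.lookup x∉ (∈-lookup i))
lookup-injective (_ ∷ uniq) (suc i) (suc j) eq = cong suc (lookup-injective uniq i j eq)

χ : ∀ {n} → Subset n → Vector ℤ n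
χ A j = if Vec.lookup A j then 1ℤ else 0ℤ

module PrimeModulusTowns (p : ℕ) (p-prime : Prime p) where

  open IntegersModulo p p-prime using (fromMod; _≈?_; commutativeRing; 1≉0; *-cancelˡ-nonZero)
  open import Data.Integer using (_+_; _*_; -_)
  open CommutativeRing commutativeRing hiding (zero; _+_; _*_; _-_; -_)
  open SemiringSum semiring
  open IntegralDomain commutativeRing (_≈? 0ℤ) *-cancelˡ-nonZero 1≉0
  open SetoidReasoning setoid

  -- The carrier is ℤ itself, so sums of indicators are exact cardinalities; congruence enters only
  -- through the town.
  sum-χ : ∀ {n} (A : Subset n) → sum (χ A) ≡ + ∣ A ∣
  sum-χ []          = ≡.refl
  sum-χ (true  ∷ A) = cong (_+_ 1ℤ) (sum-χ A)
  sum-χ (false ∷ A) = cong (_+_ 0ℤ) (sum-χ A)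

  χ·χ : ∀ {n} (A B : Subset n) → χ A · χ B ≡ + ∣ A ∩ B ∣
  χ·χ []          []          = ≡.refl
  χ·χ (true  ∷ A) (true  ∷ B) = cong (_+_ 1ℤ) (χ·χ A B)
  χ·χ (true  ∷ A) (false ∷ B) = cong (_+_ 0ℤ) (χ·χ A B)
  χ·χ (false ∷ A) (true  ∷ B) = cong (_+_ 0ℤ) (χ·χ A B)
  χ·χ (false ∷ A) (false ∷ B) = cong (_+_ 0ℤ) (χ·χ A B)

  sum-const : ∀ n x → sum {n} (const x) ≡ + n * x
  sum-const zero    x = ≡.refl
  sum-const (suc n) x = ≡.trans (cong (_+_ x) (sum-const n x)) (≡.sym (ℤ.suc-* (+ n) x))

  -- `constant-gram` with shift `a`, applied to as many members as there are points, gives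
  -- `ν * e ≈ 1ℤ`. Since `ν * α ≈ - α`, the left side is `ν - α - α * α`, which determines `ν`
  -- without dividing by `e`.
  large-town : ∀ {n a b} {F : List (Subset (suc n))} → Unique F → IsTown p a b F →
               + b ≈ 1ℤ + + a → + a + + suc n * + a ≈ 0ℤ → n < length F →
               + suc n ≈ 1ℤ + (+ a + + a * + a)
  large-town {n} {a} {b} {F} uniq town b≈1+a a+na≈0 n<∣F∣ = begin
    ν                                            ≡⟨ expand ν α ⟩
    ν * e + (α + α * α) + (α + ν * α) * (- 1ℤ - α)
      ≈⟨ +-cong {ν * e + (α + α * α)} (+-congʳ {α + α * α} νe≈1) (*-congʳ { - 1ℤ - α} a+na≈0) ⟩
    1ℤ + (α + α * α) + 0ℤ * (- 1ℤ - α)           ≡⟨ collapse α ⟩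
    e                                            ∎
    where
    open IsTown town

    ν = + suc n
    α = + a
    e = 1ℤ + (α + α * α)

    -- The last summand is arranged to contain the factor `α + ν * α`, which is zero modulo `p`.
    expand : ∀ ν α → ν ≡ ν * (1ℤ + (α + α * α)) + (α + α * α) + (α + ν * α) * (- 1ℤ - α)
    expand = solve-∀

    collapse : ∀ α → 1ℤ + (α + α * α) + 0ℤ * (- 1ℤ - α) ≡ 1ℤ + (α + α * α)
    collapse = solve-∀

    A : Fin (suc n) → Subset (suc n)
    -- `n < length F` unfolds to `suc n ≤ length F`, so the first `suc n` positions are available.
    A i = lookup F (inject≤ i n<∣F∣)

    A-injective : ∀ {i k} → i ≢ k → A i ≢ A k
    A-injective {i} {k} i≢k eq =
      i≢k (inject≤-injective n<∣F∣ n<∣F∣ i k (lookup-injective uniq _ _ eq))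

    ∣A∣≈α : ∀ i → + ∣ A i ∣ ≈ α
    ∣A∣≈α i = fromMod (size (∈-lookup (inject≤ i n<∣F∣)))

    sum-χA : ∀ i → sum (χ (A i)) ≈ α
    sum-χA i = trans (reflexive (sum-χ (A i))) (∣A∣≈α i)

    diagonal : ∀ i → χ (A i) · χ (A i) ≈ α
    diagonal i = begin
      χ (A i) · χ (A i)    ≡⟨ χ·χ (A i) (A i) ⟩
      + ∣ A i ∩ A i ∣      ≡⟨ cong (λ B → + ∣ B ∣) (∩-idem (A i)) ⟩
      + ∣ A i ∣            ≈⟨ ∣A∣≈α i ⟩
      α                    ∎

    off-diagonal : ∀ i k → i ≢ k → χ (A i) · χ (A k) ≈ 1ℤ + α
    off-diagonal i k i≢k = begin
      χ (A i) · χ (A k)    ≡⟨ χ·χ (A i) (A k) ⟩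
      + ∣ A i ∩ A k ∣      ≈⟨ fromMod (intersection (∈-lookup _) (∈-lookup _) (A-injective i≢k)) ⟩
      + b                  ≈⟨ b≈1+a ⟩
      1ℤ + α               ∎

    νe≈1 : ν * e ≈ 1ℤ
    νe≈1 = begin
      ν * e                    ≡⟨ sum-const (suc n) e ⟨
      sum {suc n} (const e)    ≈⟨ constant-gram n (λ i → χ (A i)) α
                                    (trans (reflexive (cong (_+_ α) (sum-const (suc n) α))) a+na≈0)
                                    sum-χA diagonal off-diagonal ⟩
      1ℤ                       ∎

-- Modulus three.

open import Data.Integer using (_+_; _*_)
open IntegersModulo 3 (from-yes (prime? 3)) using (_≈_; _≈?_; fromMod; commutativeRing)
open CommutativeRing commutativeRing using (trans; sym; +-congˡ; +-congʳ; *-congʳ; setoid)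
open PrimeModulusTowns 3 (from-yes (prime? 3)) using (large-town)

-- The right side takes the values 1, 3 and 7, with residues 1, 0 and 1.
2≉1+a+a² : ∀ {a} → a < 3 → ¬ + 2 ≈ 1ℤ + (+ a + + a * + a)
2≉1+a+a² {0} _ = from-no (+ 2 ≈? + 1)
2≉1+a+a² {1} _ = from-no (+ 2 ≈? + 3)
2≉1+a+a² {2} _ = from-no (+ 2 ≈? + 7)
2≉1+a+a² {suc (suc (suc _))} (s≤s (s≤s (s≤s ())))

-- This supplies the zero-sum hypothesis of `large-town` for every `a` when the ground set has size
-- 2 modulo 3.
a+2a≈0 : ∀ a → a + + 2 * a ≈ 0ℤ
a+2a≈0 a = IntegersModulo.congruent (divides a (lemma a))
  where
  lemma : ∀ a → (a + + 2 * a) - 0ℤ ≡ a * + 3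
  lemma = solve-∀

proposition1p3 : (n : ℕ) → 0 < n →
    (a b : ℕ) → a < 3 → b < 3 →
    (+ b) - (+ a) ≡ + 1 [mod 3 ] →
    (F : List (Subset n)) → Unique F →
    IsTown 3 a b F →
    (+ n ≡ + 2 [mod 3 ]) ⊎ ((+ n ≡ + 0 [mod 3 ]) × a ≡ 0 × b ≡ 1) →
    length F ≤ n ∸ 1
proposition1p3 (suc n) _ a b a<3 _ b-a≡1 F uniq town cases =
  -- Here `n` is already the predecessor of the ground-set size, so a violation of the bound means
  -- at least `suc n` members.
  ≮⇒≥ λ n<∣F∣ → excluded cases n<∣F∣
  where
  b≈1+a : + b ≈ 1ℤ + + a
  b≈1+a = begin
    + b                  ≡⟨ lemma (+ b) (+ a) ⟩
    (+ b - + a) + + a    ≈⟨ +-congʳ {+ a} (fromMod {+ b - + a} {1ℤ} b-a≡1) ⟩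
    1ℤ + + a             ∎
    where
    open SetoidReasoning setoid
    lemma : ∀ x y → x ≡ (x - y) + y
    lemma = solve-∀

  excluded : (+ suc n ≡ + 2 [mod 3 ]) ⊎ ((+ suc n ≡ + 0 [mod 3 ]) × a ≡ 0 × b ≡ 1) →
             ¬ n < length F
  excluded (inj₁ n≡2) n<∣F∣ = 2≉1+a+a² a<3
    (trans (sym n≈2) (large-town uniq town b≈1+a
      (trans (+-congˡ {+ a} (*-congʳ {+ a} n≈2)) (a+2a≈0 (+ a))) n<∣F∣))
    where
    n≈2 = fromMod n≡2
  -- With `a` equal to 0 the zero-sum hypothesis is immediate, and the conclusion of `large-town`
  -- reads `0ℤ ≈ 1ℤ`.
  excluded (inj₂ (n≡0 , ≡.refl , _)) n<∣F∣ = from-no (0ℤ ≈? 1ℤ)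
    (trans (sym n≈0) (large-town uniq town b≈1+a (+-congˡ {0ℤ} (*-congʳ {0ℤ} n≈0)) n<∣F∣))
    where
    n≈0 = fromMod n≡0
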